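{- Let $M_n$ be the $n$-th Motzkin number. Then, as Laurent series in $z$, $$\sum_{n\ge0}M_nz^n=13z^{ -1}+14z^{ -2}+\left(9z+12+24z^{ -1}+21z^{ -2}\right)\Psi(z^3)+\left(9z^5+12z^4+10z^3+23z^2+25z+19+14z^{ -1}+4z^{ -2}\right)\Psi^3(z^3)$$ $$-\left(9z^7+3z^6+24z^5+30z^4+6z^3+21z^2+6z+3+24z^{ -1}+12z^{ -2}\right)\Psi^5(z^3)\quad\text{modulo }27.$$
   Context: $M_n$ is the number of lattice paths from $(0,0)$ to $(n,0)$ with steps $(1,0),(1,1),(1,-1)$ never going below the $x$-axis; equivalently $\sum_n M_nz^n=\frac{1-z-\sqrt{1-2z-3z^2}}{2z^2}$. $\Psi(z)=\prod_{j\ge0}(1+z^{3^j})$. "Modulo $27$" means coefficientwise congruence of Laurent series. -}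

module Defs where

open import Data.Bool.Base using (if_then_else_)
open import Data.Fin.Base using (Fin; toℕ)
open import Data.Integer.Base as ℤ using (ℤ; +_; -[1+_]; 0ℤ; 1ℤ)
import Data.Integer.Divisibility as ℤᵈ
import Data.Integer.Properties as ℤₚ
open import Data.List.Base using (List; []; _∷_; length; filter; cartesianProductWith)
open import Data.Nat.Base as ℕ using (ℕ; zero; suc; NonZero; _≤_; _<_; s≤s; z≤n)
open import Data.Nat.Divisibility using (_∣?_)
import Data.Nat.Properties as ℕₚ
open import Data.Product.Base using (_×_)
open import Data.Vec.Base using (Vec; []; _∷_)
open import Function.Base using (_∘_)
open import Relation.Binary.PropositionalEquality
open import Relation.Nullary.Decidable using (Dec; does; yes; no; _×-dec_; dec-false)
open import Relation.Nullary.Negation using (contradiction)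

open import Algebra.Properties.Semiring.Sum ℤₚ.+-*-semiring
  using (sum⁺-syntax; sum-cong-≗; sum-replicate-zero)

------------------------------------------------------------------------
-- Motzkin numbers

data Step : Set where
  level up down : Step

rise : Step → ℤ
rise level = 0ℤ
rise up    = 1ℤ
rise down  = ℤ.-1ℤ

-- Every step advances the abscissa by 1, so a path from (0,h) to (n,0)
-- is a word of n steps; it never goes below the axis when each of its
-- successive heights is nonnegative.
IsPathFrom : ℤ → ∀ {n} → Vec Step n → Set
IsPathFrom h []      = h ≡ 0ℤ
IsPathFrom h (s ∷ w) = 0ℤ ℤ.≤ h × IsPathFrom (h ℤ.+ rise s) w

isPathFrom? : ∀ h {n} (w : Vec Step n) → Dec (IsPathFrom h w)
isPathFrom? h []      = h ℤₚ.≟ 0ℤ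
isPathFrom? h (s ∷ w) = (0ℤ ℤₚ.≤? h) ×-dec isPathFrom? (h ℤ.+ rise s) w

-- Each of the 3ⁿ words of length n is listed exactly once.
words : ∀ n → List (Vec Step n)
words zero    = [] ∷ []
words (suc n) = cartesianProductWith _∷_ (level ∷ up ∷ down ∷ []) (words n)

M : ℕ → ℕ
M n = length (filter (isPathFrom? 0ℤ) (words n))

------------------------------------------------------------------------
-- Formal power series over ℤ, as coefficient sequences

PowerSeries : Set
PowerSeries = ℕ → ℤ

infixl 6 _⊕_
infixl 7 _⊛_
infix  9 _⟨z^_⟩

monomial : ℤ → ℕ → PowerSeries
monomial c e n = if does (e ℕₚ.≟ n) then c else 0ℤ

_⊕_ : PowerSeries → PowerSeries → PowerSeries
(f ⊕ g) n = f n ℤ.+ g n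

_⊛_ : PowerSeries → PowerSeries → PowerSeries
(f ⊛ g) n = ∑[ i ≤ n ] (f (toℕ i) ℤ.* g (n ℕ.∸ toℕ i))

-- f ⟨z^ m ⟩ is f(zᵐ).
_⟨z^_⟩ : PowerSeries → (m : ℕ) .{{_ : NonZero m}} → PowerSeries
(f ⟨z^ m ⟩) n = if does (m ∣? n) then f (n ℕ./ m) else 0ℤ

Ψ-factor : ℕ → PowerSeries
Ψ-factor j = monomial 1ℤ 0 ⊕ monomial 1ℤ (3 ℕ.^ j)

-- The product of the factors with index j < k.
Ψ-partial : ℕ → PowerSeries
Ψ-partial zero    = monomial 1ℤ 0
Ψ-partial (suc k) = Ψ-factor k ⊛ Ψ-partial k

-- The coefficient of zⁿ is the same in all partial products with at
-- least n factors (Ψ-limit below), since n < 3ʲ for every j ≥ n.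
Ψ : PowerSeries
Ψ n = Ψ-partial n n

private
  n<3^n : ∀ n → n < 3 ℕ.^ n
  n<3^n zero    = s≤s z≤n
  n<3^n (suc n) = ℕₚ.<-≤-trans (s≤s (n<3^n n))
    (ℕₚ.+-mono-≤ (ℕₚ.m^n>0 3 n) (ℕₚ.m≤m+n (3 ℕ.^ n) _))

  monomial-≢ : ∀ {c e n} → e ≢ n → monomial c e n ≡ 0ℤ
  monomial-≢ {c} {e} {n} e≢n =
    cong (λ b → if b then c else 0ℤ) (dec-false (e ℕₚ.≟ n) e≢n)

  factor-⊛ : ∀ j f n → n < 3 ℕ.^ j → (Ψ-factor j ⊛ f) n ≡ f n
  factor-⊛ j f n n<3^j = begin
    (Ψ-factor j ⊛ f) n
      ≡⟨ cong₂ ℤ._+_ head-term tail-terms ⟩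
    f n ℤ.+ 0ℤ
      ≡⟨ ℤₚ.+-identityʳ (f n) ⟩
    f n ∎
    where
    open ≡-Reasoning

    head-term : Ψ-factor j 0 ℤ.* f n ≡ f n
    head-term = trans
      (cong (λ x → (1ℤ ℤ.+ x) ℤ.* f n)
        (monomial-≢ (ℕₚ.m<n⇒n≢0 n<3^j)))
      (ℤₚ.*-identityˡ (f n))

    term : ∀ (i : Fin n) →
      Ψ-factor j (suc (toℕ i)) ℤ.* f (n ℕ.∸ suc (toℕ i)) ≡ 0ℤ
    term i = cong (λ x → (0ℤ ℤ.+ x) ℤ.* f (n ℕ.∸ suc (toℕ i)))
      (monomial-≢ (ℕₚ.>⇒≢ (ℕₚ.≤-<-trans (toℕ<n i) n<3^j)))
      where open import Data.Fin.Properties using (toℕ<n)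

    tail-terms = trans (sum-cong-≗ term) (sum-replicate-zero n)

Ψ-limit : ∀ n k → n ≤ k → Ψ-partial k n ≡ Ψ n
Ψ-limit n k n≤k = go (ℕₚ.≤⇒≤′ n≤k)
  where
  go : ∀ {k} → n ℕ.≤′ k → Ψ-partial k n ≡ Ψ n
  go (ℕ.≤′-reflexive refl) = refl
  go (ℕ.≤′-step {k} n≤′k) = trans
    (factor-⊛ k (Ψ-partial k) n
      (ℕₚ.<-≤-trans (n<3^n n) (ℕₚ.^-monoʳ-≤ 3 (ℕₚ.≤′⇒≤ n≤′k))))
    (go n≤′k)

------------------------------------------------------------------------
-- Formal Laurent series over ℤ

-- z^(-pole) · Σₙ body n · zⁿ.  The representation is not unique; series
-- are compared through coeff.
record Laurent : Set where
  constructor laurent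
  field
    pole : ℕ
    body : PowerSeries

open Laurent public

atℤ : PowerSeries → ℤ → ℤ
atℤ f (+ n)    = f n
atℤ f -[1+ _ ] = 0ℤ

coeff : Laurent → ℤ → ℤ
coeff f k = atℤ (body f) (k ℤ.+ + pole f)

infixl 6 _+_ _-_
infixl 7 _*_
infixr 8 _^_
infix  9 _z^_ _z^-_

series : PowerSeries → Laurent
series = laurent 0

_z^_ : ℕ → ℕ → Laurent
c z^ e = series (monomial (+ c) e)

-- c z^- e is c · z⁻ᵉ.
_z^-_ : ℕ → ℕ → Laurent
c z^- e = laurent e (monomial (+ c) 0)

_+_ : Laurent → Laurent → Laurent
f + g = laurent p (λ n → coeff f (n ℤ.⊖ p) ℤ.+ coeff g (n ℤ.⊖ p))
  where p = pole f ℕ.⊔ pole g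

_-_ : Laurent → Laurent → Laurent
f - g = f + laurent (pole g) (ℤ.-_ ∘ body g)

_*_ : Laurent → Laurent → Laurent
f * g = laurent (pole f ℕ.+ pole g) (body f ⊛ body g)

_^_ : Laurent → ℕ → Laurent
f ^ zero  = 1 z^ 0
f ^ suc n = f * f ^ n

infix 4 _≈_[mod_]

_≈_[mod_] : Laurent → Laurent → ℕ → Set
f ≈ g [mod m ] = ∀ k → + m ℤᵈ.∣ coeff f k ℤ.- coeff g k

{-# OPTIONS --safe #-}
module Submission where

-- Write X = Ψ(z³).  Modulo 3 the product for X² (1 + z³) telescopes, because
-- (1 + y)³ ≡ 1 + y³, so X² (1 + z³) = 1 + 3u for some power series u.  Up to
-- the factor z², the right-hand side is (1 - z)/2 + s with s odd in X, and
-- modulo 27 the identity 4 s² ≡ 1 - 2z - 3z² becomes, after multiplication by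
-- (1 + z³)⁵, an identity of polynomials in z and u.  As the coefficients of
-- z⁻² and z⁻¹ vanish, the right-hand side is a power series f that satisfies
-- f ≡ 1 + z f + z² f².  For any such f, the series zʰ fʰ⁺¹ obey the recursion
-- for the numbers of paths from height h to 0, so induction on the length
-- gives M ≡ f.

open import Defs
open import Data.Integer.Base as ℤ using (ℤ; +_; -[1+_]; 0ℤ; 1ℤ; _⊖_)
open import Data.Integer.Divisibility.Signed
  using (_∣_; divides; quotient; _∣?_; ∣⇒∣ᵤ; ∣m∣n⇒∣m+n; ∣m⇒∣-m; ∣m⇒∣m*n; ∣n⇒∣m*n)
import Data.Integer.Properties as ℤₚ
open import Data.Integer.Tactic.RingSolver using (solve-∀)
open import Data.Bool.Base using (true; false; if_then_else_)
open import Data.Fin.Base using (zero; suc)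
open import Data.List.Base using (List; []; _∷_; map; length; filter; _++_)
open import Data.List.Properties using (length-++; filter-++)
open import Data.Maybe.Base using (Maybe; just; nothing)
open import Data.Nat.Base as ℕ using (ℕ; zero; suc; _≤_; z≤n; s≤s)
import Data.Nat.Divisibility as ℕᵈ
import Data.Nat.DivMod as ℕᵐ
import Data.Nat.Properties as ℕₚ
open import Data.Product.Base using (_,_)
open import Data.Vec.Base using (Vec; []; _∷_)
open import Algebra.Bundles using (CommutativeRing; RawRing)
open import Algebra.Structures using (IsCommutativeRing)
import Algebra.Solver.Ring as RingSolver
open import Algebra.Solver.Ring.AlmostCommutativeRing
  using (fromCommutativeRing; _-Raw-AlmostCommutative⟶_; Induced-equivalence)
open import Function.Base using (_∘_)
open import Level using (0ℓ)
open import Relation.Binary.Definitions using (WeaklyDecidable)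
open import Relation.Binary.PropositionalEquality
  using (_≡_; _≗_; refl; sym; trans; cong; cong₂; subst; module ≡-Reasoning)
open import Relation.Nullary.Decidable using (does; yes; no; dec-false; from-yes)
open import Relation.Unary using (Decidable)

-- The Cauchy product

tail : PowerSeries → PowerSeries
tail f = f ∘ suc

scale : ℤ → PowerSeries → PowerSeries
scale c f n = c ℤ.* f n

-- `(f ⊛ g) (suc n)` unfolds to `f 0 ℤ.* g (suc n) ℤ.+ (tail f ⊛ g) n`, so laws of the product
-- follow by induction on the index, with `f` generalised.
⊛-distribʳ : ∀ f g h n → ((f ⊕ g) ⊛ h) n ≡ (f ⊛ h) n ℤ.+ (g ⊛ h) n
⊛-distribʳ f g h zero = lemma (f 0) (g 0) (h 0)
  where
  lemma : ∀ a b c →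
    (a ℤ.+ b) ℤ.* c ℤ.+ 0ℤ ≡ (a ℤ.* c ℤ.+ 0ℤ) ℤ.+ (b ℤ.* c ℤ.+ 0ℤ)
  lemma = solve-∀
⊛-distribʳ f g h (suc n) = trans
  (cong (ℤ._+_ ((f ⊕ g) 0 ℤ.* h (suc n))) (⊛-distribʳ (tail f) (tail g) h n))
  (lemma (f 0) (g 0) (h (suc n)) _ _)
  where
  lemma : ∀ a b c d e → (a ℤ.+ b) ℤ.* c ℤ.+ (d ℤ.+ e) ≡
    (a ℤ.* c ℤ.+ d) ℤ.+ (b ℤ.* c ℤ.+ e)
  lemma = solve-∀

scale-⊛ : ∀ c f g n → (scale c f ⊛ g) n ≡ c ℤ.* (f ⊛ g) n
scale-⊛ c f g zero = lemma c (f 0) (g 0)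
  where
  lemma : ∀ a b c → (a ℤ.* b) ℤ.* c ℤ.+ 0ℤ ≡ a ℤ.* (b ℤ.* c ℤ.+ 0ℤ)
  lemma = solve-∀
scale-⊛ c f g (suc n) = trans
  (cong (ℤ._+_ (scale c f 0 ℤ.* g (suc n))) (scale-⊛ c (tail f) g n))
  (lemma c (f 0) (g (suc n)) _)
  where
  lemma : ∀ a b c d →
    (a ℤ.* b) ℤ.* c ℤ.+ a ℤ.* d ≡ a ℤ.* (b ℤ.* c ℤ.+ d)
  lemma = solve-∀

⊛-assoc : ∀ f g h n → ((f ⊛ g) ⊛ h) n ≡ (f ⊛ (g ⊛ h)) n
⊛-assoc f g h zero = lemma (f 0) (g 0) (h 0)
  where
  lemma : ∀ a b c → (a ℤ.* b ℤ.+ 0ℤ) ℤ.* c ℤ.+ 0ℤ ≡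
    a ℤ.* (b ℤ.* c ℤ.+ 0ℤ) ℤ.+ 0ℤ
  lemma = solve-∀
⊛-assoc f g h (suc n) = begin
  -- The tail of `f ⊛ g` is definitionally `scale (f 0) (tail g) ⊕ (tail f ⊛ g)`.
  (f ⊛ g) 0 ℤ.* h (suc n) ℤ.+ ((scale (f 0) (tail g) ⊕ (tail f ⊛ g)) ⊛ h) n
    ≡⟨ cong (ℤ._+_ ((f ⊛ g) 0 ℤ.* h (suc n)))
         (⊛-distribʳ (scale (f 0) (tail g)) (tail f ⊛ g) h n) ⟩
  (f ⊛ g) 0 ℤ.* h (suc n) ℤ.+
    ((scale (f 0) (tail g) ⊛ h) n ℤ.+ ((tail f ⊛ g) ⊛ h) n)
    ≡⟨ cong₂ (λ x y → (f ⊛ g) 0 ℤ.* h (suc n) ℤ.+ (x ℤ.+ y))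
         (scale-⊛ (f 0) (tail g) h n) (⊛-assoc (tail f) g h n) ⟩
  (f ⊛ g) 0 ℤ.* h (suc n) ℤ.+
    (f 0 ℤ.* (tail g ⊛ h) n ℤ.+ (tail f ⊛ (g ⊛ h)) n)
    ≡⟨ lemma (f 0) (g 0) (h (suc n)) _ _ ⟩
  (f ⊛ (g ⊛ h)) (suc n) ∎
  where
  open ≡-Reasoning
  lemma : ∀ a b c d e → (a ℤ.* b ℤ.+ 0ℤ) ℤ.* c ℤ.+ (a ℤ.* d ℤ.+ e) ≡
    a ℤ.* (b ℤ.* c ℤ.+ d) ℤ.+ e
  lemma = solve-∀

-- The product unfolds along its left factor; splitting off the constant term of the right factor
-- instead is what commutativity needs.
⊛-sucʳ : ∀ f g n → (f ⊛ g) (suc n) ≡ f (suc n) ℤ.* g 0 ℤ.+ (f ⊛ tail g) n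
⊛-sucʳ f g zero = lemma (f 0) (g 1) (f 1) (g 0)
  where
  lemma : ∀ a b c d → a ℤ.* b ℤ.+ (c ℤ.* d ℤ.+ 0ℤ) ≡
    c ℤ.* d ℤ.+ (a ℤ.* b ℤ.+ 0ℤ)
  lemma = solve-∀
⊛-sucʳ f g (suc n) = trans
  (cong (ℤ._+_ (f 0 ℤ.* g (suc (suc n)))) (⊛-sucʳ (tail f) g n))
  (lemma (f 0 ℤ.* g (suc (suc n))) (f (suc (suc n)) ℤ.* g 0) _)
  where
  lemma : ∀ a b c → a ℤ.+ (b ℤ.+ c) ≡ b ℤ.+ (a ℤ.+ c)
  lemma = solve-∀

⊛-comm : ∀ f g n → (f ⊛ g) n ≡ (g ⊛ f) n
⊛-comm f g zero = cong (ℤ._+ 0ℤ) (ℤₚ.*-comm (f 0) (g 0))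
⊛-comm f g (suc n) = trans
  (cong₂ ℤ._+_ (ℤₚ.*-comm (f 0) (g (suc n))) (⊛-comm (tail f) g n))
  (sym (⊛-sucʳ g f n))

-- Polynomials as coefficient lists, lowest degree first

Poly : Set
Poly = List ℤ

⟦_⟧ : Poly → PowerSeries
⟦ []    ⟧ n       = 0ℤ
⟦ a ∷ p ⟧ zero    = a
⟦ a ∷ p ⟧ (suc n) = ⟦ p ⟧ n

addₚ : Poly → Poly → Poly
addₚ []      q       = q
addₚ (a ∷ p) []      = a ∷ p
addₚ (a ∷ p) (b ∷ q) = a ℤ.+ b ∷ addₚ p q

mulₚ : Poly → Poly → Poly
mulₚ []      q = []
mulₚ (a ∷ p) q = addₚ (map (a ℤ.*_) q) (0ℤ ∷ mulₚ p q)

negₚ : Poly → Poly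
negₚ = map (ℤ.-_)

⟦addₚ⟧ : ∀ p q n → ⟦ addₚ p q ⟧ n ≡ ⟦ p ⟧ n ℤ.+ ⟦ q ⟧ n
⟦addₚ⟧ []      q       n       = sym (ℤₚ.+-identityˡ _)
⟦addₚ⟧ (a ∷ p) []      n       = sym (ℤₚ.+-identityʳ _)
⟦addₚ⟧ (a ∷ p) (b ∷ q) zero    = refl
⟦addₚ⟧ (a ∷ p) (b ∷ q) (suc n) = ⟦addₚ⟧ p q n

⟦negₚ⟧ : ∀ p n → ⟦ negₚ p ⟧ n ≡ ℤ.- ⟦ p ⟧ n
⟦negₚ⟧ []      n       = refl
⟦negₚ⟧ (a ∷ p) zero    = refl
⟦negₚ⟧ (a ∷ p) (suc n) = ⟦negₚ⟧ p n

⟦map-*⟧ : ∀ c p n → ⟦ map (c ℤ.*_) p ⟧ n ≡ c ℤ.* ⟦ p ⟧ n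
⟦map-*⟧ c []      n       = sym (ℤₚ.*-zeroʳ c)
⟦map-*⟧ c (a ∷ p) zero    = refl
⟦map-*⟧ c (a ∷ p) (suc n) = ⟦map-*⟧ c p n

⊛-zeroˡ : ∀ f n → (⟦ [] ⟧ ⊛ f) n ≡ 0ℤ
⊛-zeroˡ f zero    = refl
⊛-zeroˡ f (suc n) = trans (ℤₚ.+-identityˡ _) (⊛-zeroˡ f n)

⟦mulₚ⟧ : ∀ p q n → ⟦ mulₚ p q ⟧ n ≡ (⟦ p ⟧ ⊛ ⟦ q ⟧) n
⟦mulₚ⟧ []      q n       = sym (⊛-zeroˡ ⟦ q ⟧ n)
⟦mulₚ⟧ (a ∷ p) q zero    = trans
  (⟦addₚ⟧ (map (a ℤ.*_) q) (0ℤ ∷ mulₚ p q) zero)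
  (cong (ℤ._+ 0ℤ) (⟦map-*⟧ a q zero))
⟦mulₚ⟧ (a ∷ p) q (suc n) = trans
  (⟦addₚ⟧ (map (a ℤ.*_) q) (0ℤ ∷ mulₚ p q) (suc n))
  (cong₂ ℤ._+_ (⟦map-*⟧ a q (suc n)) (⟦mulₚ⟧ p q n))

⊛-identityˡ : ∀ f n → (⟦ 1ℤ ∷ [] ⟧ ⊛ f) n ≡ f n
⊛-identityˡ f zero    = trans (ℤₚ.+-identityʳ _) (ℤₚ.*-identityˡ _)
⊛-identityˡ f (suc n) = trans
  (cong₂ ℤ._+_ (ℤₚ.*-identityˡ (f (suc n))) (⊛-zeroˡ f n)) (ℤₚ.+-identityʳ _)

⟦const⟧-⊛ : ∀ c f n → (⟦ c ∷ [] ⟧ ⊛ f) n ≡ c ℤ.* f n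
⟦const⟧-⊛ c f zero    = ℤₚ.+-identityʳ _
⟦const⟧-⊛ c f (suc n) = trans
  (cong (ℤ._+_ (c ℤ.* f (suc n))) (⊛-zeroˡ f n)) (ℤₚ.+-identityʳ _)

-- Opaque copies of the operations, which keep ring expressions from being
-- expanded into sums during type checking.
infixl 6 _∔_
infixl 7 _·_
infix  8 ⊝_

opaque
  _∔_ _·_ : PowerSeries → PowerSeries → PowerSeries
  f ∔ g = f ⊕ g
  f · g = f ⊛ g

  ⊝_ : PowerSeries → PowerSeries
  ⊝ f = ℤ.-_ ∘ f

  ∔-at : ∀ f g n → (f ∔ g) n ≡ f n ℤ.+ g n
  ∔-at f g n = refl

nats : List ℕ → Poly
nats = map (λ c → + c)

-- Power series with coefficients modulo m

module Modulo (m : ℕ) where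

  infix 4 _∼_ _≈_

  record _∼_ (a b : ℤ) : Set where
    constructor congruent
    field difference : + m ∣ a ℤ.- b

  open _∼_ public

  ∼-reflexive : ∀ {a b} → a ≡ b → a ∼ b
  ∼-reflexive {a} refl = congruent (divides 0ℤ (ℤₚ.+-inverseʳ a))

  ∼-sym : ∀ {a b} → a ∼ b → b ∼ a
  ∼-sym {a} {b} (congruent d) =
    congruent (subst (+ m ∣_) (lemma a b) (∣m⇒∣-m d))
    where
    lemma : ∀ a b → ℤ.- (a ℤ.- b) ≡ b ℤ.- a
    lemma = solve-∀

  ∼-trans : ∀ {a b c} → a ∼ b → b ∼ c → a ∼ c
  ∼-trans {a} {b} {c} (congruent d) (congruent e) =
    congruent (subst (+ m ∣_) (lemma a b c) (∣m∣n⇒∣m+n d e))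
    where
    lemma : ∀ a b c → (a ℤ.- b) ℤ.+ (b ℤ.- c) ≡ a ℤ.- c
    lemma = solve-∀

  ∼-+ : ∀ {a b c d} → a ∼ b → c ∼ d → a ℤ.+ c ∼ b ℤ.+ d
  ∼-+ {a} {b} {c} {d} (congruent p) (congruent q) =
    congruent (subst (+ m ∣_) (lemma a b c d) (∣m∣n⇒∣m+n p q))
    where
    lemma : ∀ a b c d → (a ℤ.- b) ℤ.+ (c ℤ.- d) ≡ (a ℤ.+ c) ℤ.- (b ℤ.+ d)
    lemma = solve-∀

  ∼-* : ∀ {a b c d} → a ∼ b → c ∼ d → a ℤ.* c ∼ b ℤ.* d
  ∼-* {a} {b} {c} {d} (congruent p) (congruent q) =
    congruent (subst (+ m ∣_) (lemma a b c d)
      (∣m∣n⇒∣m+n (∣m⇒∣m*n c p) (∣n⇒∣m*n b q)))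
    where
    lemma : ∀ a b c d →
      (a ℤ.- b) ℤ.* c ℤ.+ b ℤ.* (c ℤ.- d) ≡ a ℤ.* c ℤ.- b ℤ.* d
    lemma = solve-∀

  ∼-neg : ∀ {a b} → a ∼ b → ℤ.- a ∼ ℤ.- b
  ∼-neg {a} {b} (congruent p) =
    congruent (subst (+ m ∣_) (lemma a b) (∣m⇒∣-m p))
    where
    lemma : ∀ a b → ℤ.- (a ℤ.- b) ≡ (ℤ.- a) ℤ.- (ℤ.- b)
    lemma = solve-∀

  record _≈_ (f g : PowerSeries) : Set where
    constructor pointwise
    field at : ∀ n → f n ∼ g n

  open _≈_ public

  ≗⇒≈ : ∀ {f g} → f ≗ g → f ≈ g
  ≗⇒≈ e = pointwise (∼-reflexive ∘ e)

  quotients : ∀ {f g} → f ≈ g → PowerSeries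
  quotients f≈g n = quotient (difference (at f≈g n))

  opaque
    unfolding _∔_ _·_

    -- An exact equality can be read in any modulus: this carries a congruence modulo 3 into
    -- arithmetic modulo 27, with the quotients as an unknown series.
    ≈⇒≗ : ∀ {f g} (f≈g : f ≈ g) → f ≗ g ∔ ⟦ + m ∷ [] ⟧ · quotients f≈g
    ≈⇒≗ {f} {g} f≈g n = begin
      f n
        ≡⟨ lemma (f n) (g n) ⟩
      g n ℤ.+ (f n ℤ.- g n)
        ≡⟨ cong (ℤ._+_ (g n)) (_∣_.equality (difference (at f≈g n))) ⟩
      g n ℤ.+ quotients f≈g n ℤ.* + m
        ≡⟨ cong (ℤ._+_ (g n)) (ℤₚ.*-comm (quotients f≈g n) (+ m)) ⟩
      g n ℤ.+ + m ℤ.* quotients f≈g n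
        ≡⟨ cong (ℤ._+_ (g n)) (⟦const⟧-⊛ (+ m) (quotients f≈g) n) ⟨
      (g ⊕ (⟦ + m ∷ [] ⟧ ⊛ quotients f≈g)) n ∎
      where
      open ≡-Reasoning
      lemma : ∀ a b → a ≡ b ℤ.+ (a ℤ.- b)
      lemma = solve-∀

  -- Coefficient `n` of a product involves only indices up to `n`. The bounds allow an infinite
  -- product to be replaced by a truncation depending on `n`.
  ⊛-cong-≤ : ∀ n {f f′ g g′} → (∀ {i} → i ≤ n → f i ∼ f′ i) →
    (∀ {i} → i ≤ n → g i ∼ g′ i) → (f ⊛ g) n ∼ (f′ ⊛ g′) n
  ⊛-cong-≤ zero    p q = ∼-+ (∼-* (p z≤n) (q z≤n)) (∼-reflexive refl)
  ⊛-cong-≤ (suc n) p q = ∼-+ (∼-* (p z≤n) (q ℕₚ.≤-refl))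
    (⊛-cong-≤ n (p ∘ s≤s) (q ∘ ℕₚ.m≤n⇒m≤1+n))

  opaque
    unfolding _∔_ _·_ ⊝_

    isCommutativeRing : IsCommutativeRing _≈_ _∔_ _·_ ⊝_ ⟦ [] ⟧ ⟦ 1ℤ ∷ [] ⟧
    isCommutativeRing = record
      { isRing = record
        { +-isAbelianGroup = record
          { isGroup = record
            { isMonoid = record
              { isSemigroup = record
                { isMagma = record
                  { isEquivalence = record
                    { refl  = ≗⇒≈ (λ _ → refl)
                    ; sym   = λ p → pointwise (∼-sym ∘ at p)
                    ; trans = λ p q → pointwise (λ n → ∼-trans (at p n) (at q n))
                    }
                  ; ∙-cong = λ p q → pointwise (λ n → ∼-+ (at p n) (at q n))
                  }
                ; assoc = λ f g h → ≗⇒≈ (λ n → ℤₚ.+-assoc (f n) (g n) (h n))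
                }
              ; identity = (λ f → ≗⇒≈ (ℤₚ.+-identityˡ ∘ f))
                         , (λ f → ≗⇒≈ (ℤₚ.+-identityʳ ∘ f))
              }
            ; inverse = (λ f → ≗⇒≈ (ℤₚ.+-inverseˡ ∘ f))
                      , (λ f → ≗⇒≈ (ℤₚ.+-inverseʳ ∘ f))
            ; ⁻¹-cong = λ p → pointwise (∼-neg ∘ at p)
            }
          ; comm = λ f g → ≗⇒≈ (λ n → ℤₚ.+-comm (f n) (g n))
          }
        ; *-cong = λ p q → pointwise (λ n →
            ⊛-cong-≤ n (λ {i} _ → at p i) (λ {i} _ → at q i))
        ; *-assoc = λ f g h → ≗⇒≈ (⊛-assoc f g h)
        ; *-identity = (λ f → ≗⇒≈ (⊛-identityˡ f))
                     , (λ f → ≗⇒≈ (λ n → trans (⊛-comm f ⟦ 1ℤ ∷ [] ⟧ n) (⊛-identityˡ f n)))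
        ; distrib = (λ f g h → ≗⇒≈ (λ n → trans (⊛-comm f (g ⊕ h) n)
                      (trans (⊛-distribʳ g h f n)
                        (cong₂ ℤ._+_ (⊛-comm g f n) (⊛-comm h f n)))))
                  , (λ f g h → ≗⇒≈ (⊛-distribʳ g h f))
        }
      ; *-comm = λ f g → ≗⇒≈ (⊛-comm f g)
      }

  commutativeRing : CommutativeRing 0ℓ 0ℓ
  commutativeRing = record { isCommutativeRing = isCommutativeRing }

  open CommutativeRing commutativeRing public
    using (setoid; semiring; +-cong; +-congˡ; *-cong; *-congˡ; *-congʳ; -‿cong; *-assoc)
    renaming (refl to ≈-refl; sym to ≈-sym; trans to ≈-trans)

  open import Algebra.Properties.Semiring.Exp semiring using (^-congˡ)

  -- A ring solver with polynomials in z as coefficients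

  polyRing : RawRing 0ℓ 0ℓ
  polyRing = record
    { Carrier = Poly
    ; _≈_ = _≡_
    ; _+_ = addₚ
    ; _*_ = mulₚ
    ; -_  = negₚ
    ; 0#  = []
    ; 1#  = 1ℤ ∷ []
    }

  opaque
    unfolding _∔_ _·_ ⊝_

    ⟦addₚ⟧≈ : ∀ p q → ⟦ addₚ p q ⟧ ≈ ⟦ p ⟧ ∔ ⟦ q ⟧
    ⟦addₚ⟧≈ p q = ≗⇒≈ (⟦addₚ⟧ p q)

    ⟦mulₚ⟧≈ : ∀ p q → ⟦ mulₚ p q ⟧ ≈ ⟦ p ⟧ · ⟦ q ⟧
    ⟦mulₚ⟧≈ p q = ≗⇒≈ (⟦mulₚ⟧ p q)

    ⟦negₚ⟧≈ : ∀ p → ⟦ negₚ p ⟧ ≈ ⊝ ⟦ p ⟧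
    ⟦negₚ⟧≈ p = ≗⇒≈ (⟦negₚ⟧ p)

  ⟦⟧-homo : polyRing -Raw-AlmostCommutative⟶ fromCommutativeRing commutativeRing
  ⟦⟧-homo = record
    { ⟦_⟧    = ⟦_⟧
    ; +-homo = ⟦addₚ⟧≈
    ; *-homo = ⟦mulₚ⟧≈
    ; -‿homo = ⟦negₚ⟧≈
    ; 0-homo = ≈-refl
    ; 1-homo = ≈-refl
    }

  ⟦⟧≈0? : ∀ p → Maybe (⟦ p ⟧ ≈ ⟦ [] ⟧)
  ⟦⟧≈0? [] = just ≈-refl
  ⟦⟧≈0? (a ∷ p) with + m ∣? (a ℤ.- 0ℤ) | ⟦⟧≈0? p
  ... | yes d | just e = just (pointwise λ { zero → congruent d ; (suc n) → at e n })
  ... | _     | _      = nothing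

  -- Lists of different lengths may agree modulo `m`, so surplus coefficients are tested for
  -- divisibility by `m`.
  ⟦⟧≈? : WeaklyDecidable (Induced-equivalence ⟦⟧-homo)
  ⟦⟧≈? []      []      = just ≈-refl
  ⟦⟧≈? []      (b ∷ q) with ⟦⟧≈0? (b ∷ q)
  ... | just e  = just (≈-sym e)
  ... | nothing = nothing
  ⟦⟧≈? (a ∷ p) []      = ⟦⟧≈0? (a ∷ p)
  ⟦⟧≈? (a ∷ p) (b ∷ q) with + m ∣? (a ℤ.- b) | ⟦⟧≈? p q
  ... | yes d | just e = just (pointwise λ { zero → congruent d ; (suc n) → at e n })
  ... | _     | _      = nothing

  open RingSolver polyRing (fromCommutativeRing commutativeRing) ⟦⟧-homo ⟦⟧≈? public
    using (Polynomial; op; [+]; [*]; con; var; _:+_; _:*_; _:-_; :-_; _:^_; normalise; 0N)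
    renaming (⟦_⟧ to eval)
  open RingSolver polyRing (fromCommutativeRing commutativeRing) ⟦⟧-homo ⟦⟧≈?
    using (correct; 0N-homo)

  eval-cong : ∀ (e : Polynomial 1) {f g} → f ≈ g →
    eval e (f ∷ []) ≈ eval e (g ∷ [])
  eval-cong (op [+] e₁ e₂) f≈g = +-cong (eval-cong e₁ f≈g) (eval-cong e₂ f≈g)
  eval-cong (op [*] e₁ e₂) f≈g = *-cong (eval-cong e₁ f≈g) (eval-cong e₂ f≈g)
  eval-cong (con p)        f≈g = ≈-refl
  eval-cong (var zero)     f≈g = f≈g
  eval-cong (e :^ n)       f≈g = ^-congˡ n (eval-cong e f≈g)
  eval-cong (:- e)         f≈g = -‿cong (eval-cong e f≈g)

  -- The difference is normalised because congruent polynomials can have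
  -- different normal forms, unless one of them is zero.
  solve-≈ : ∀ {n} (e₁ e₂ : Polynomial n) ρ → normalise (e₁ :- e₂) ≡ 0N →
    eval e₁ ρ ≈ eval e₂ ρ
  solve-≈ e₁ e₂ ρ eq = x∙y⁻¹≈ε⇒x≈y (eval e₁ ρ) (eval e₂ ρ) (≈-trans
    (≈-sym (correct (e₁ :- e₂) ρ)) (≈-trans (reflexive (cong (λ e → normal e ρ) eq)) (0N-homo ρ)))
    where
    open CommutativeRing commutativeRing using (reflexive; +-group)
    open import Algebra.Properties.Group +-group using (x∙y⁻¹≈ε⇒x≈y)
    open RingSolver polyRing (fromCommutativeRing commutativeRing) ⟦⟧-homo ⟦⟧≈?
      using () renaming (⟦_⟧N to normal)

  pattern x₀ = var zero
  pattern x₁ = var (suc zero)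

  int : ∀ {n} → ℕ → Polynomial n
  int c = con (+ c ∷ [])

-- The substitution z ↦ z³

monomial-suc-⊛-zero : ∀ c e f → (monomial c (suc e) ⊛ f) 0 ≡ 0ℤ
monomial-suc-⊛-zero c e f = trans (ℤₚ.+-identityʳ _) (ℤₚ.*-zeroˡ (f 0))

monomial-suc-⊛-suc : ∀ c e f n →
  (monomial c (suc e) ⊛ f) (suc n) ≡ (monomial c e ⊛ f) n
monomial-suc-⊛-suc c e f n = trans
  (cong (ℤ._+ ((monomial c e ⊛ f) n)) (ℤₚ.*-zeroˡ (f (suc n)))) (ℤₚ.+-identityˡ _)

monomial₀-≗ : ∀ c → monomial c 0 ≗ ⟦ c ∷ [] ⟧
monomial₀-≗ c zero    = refl
monomial₀-≗ c (suc n) = refl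

⊛-congˡ-≗ : ∀ {f f′} g → f ≗ f′ → f ⊛ g ≗ f′ ⊛ g
⊛-congˡ-≗ g e zero    = cong (λ x → x ℤ.* g 0 ℤ.+ 0ℤ) (e 0)
⊛-congˡ-≗ g e (suc n) =
  cong₂ (λ x y → x ℤ.* g (suc n) ℤ.+ y) (e 0) (⊛-congˡ-≗ g (e ∘ suc) n)

monomial₁-⊛ : ∀ f → monomial 1ℤ 0 ⊛ f ≗ f
monomial₁-⊛ f n = trans (⊛-congˡ-≗ f (monomial₀-≗ 1ℤ) n) (⊛-identityˡ f n)

monomial-⊛ : ∀ d e → monomial 1ℤ d ⊛ monomial 1ℤ e ≗ monomial 1ℤ (d ℕ.+ e)
monomial-⊛ zero    e n       = monomial₁-⊛ (monomial 1ℤ e) n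
monomial-⊛ (suc d) e zero    = monomial-suc-⊛-zero 1ℤ d (monomial 1ℤ e)
monomial-⊛ (suc d) e (suc n) =
  trans (monomial-suc-⊛-suc 1ℤ d (monomial 1ℤ e) n) (monomial-⊛ d e n)

⟨z³⟩-cong : ∀ {f g} → f ≗ g → f ⟨z^ 3 ⟩ ≗ g ⟨z^ 3 ⟩
⟨z³⟩-cong e n = cong (λ x → if does (3 ℕᵈ.∣? n) then x else 0ℤ) (e (n ℕ./ 3))

⟨z³⟩-⊕ : ∀ f g → (f ⊕ g) ⟨z^ 3 ⟩ ≗ f ⟨z^ 3 ⟩ ⊕ g ⟨z^ 3 ⟩
⟨z³⟩-⊕ f g n with does (3 ℕᵈ.∣? n)
... | true  = refl
... | false = refl

⟨z³⟩-tail : ∀ f n → (f ⟨z^ 3 ⟩) (3 ℕ.+ n) ≡ (tail f ⟨z^ 3 ⟩) n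
-- The test whether 3 divides `3 ℕ.+ n` computes to the test for `n`, so only the quotients remain
-- to be compared.
⟨z³⟩-tail f n = cong (λ x → if does (3 ℕᵈ.∣? n) then f x else 0ℤ)
  (ℕᵐ.m/n≡1+[m∸n]/n {3 ℕ.+ n} {3} (s≤s (s≤s (s≤s z≤n))))

-- Induction on `e`: removing one factor z before the substitution removes three after it.
⟨z³⟩-monomial-⊛ : ∀ e f →
  (monomial 1ℤ e ⊛ f) ⟨z^ 3 ⟩ ≗ monomial 1ℤ (e ℕ.* 3) ⊛ f ⟨z^ 3 ⟩
⟨z³⟩-monomial-⊛ zero f n =
  trans (⟨z³⟩-cong (monomial₁-⊛ f) n) (sym (monomial₁-⊛ (f ⟨z^ 3 ⟩) n))
⟨z³⟩-monomial-⊛ (suc e) f 0 = trans (monomial-suc-⊛-zero 1ℤ e f)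
  (sym (monomial-suc-⊛-zero 1ℤ (2 ℕ.+ e ℕ.* 3) (f ⟨z^ 3 ⟩)))
-- At the indices 1 and 2 the left side is 0 because 3 does not divide the index, the right side
-- because its monomial has exponent at least 3.
⟨z³⟩-monomial-⊛ (suc e) f 1 = sym (trans
  (monomial-suc-⊛-suc 1ℤ (2 ℕ.+ e ℕ.* 3) (f ⟨z^ 3 ⟩) 0)
  (monomial-suc-⊛-zero 1ℤ (1 ℕ.+ e ℕ.* 3) (f ⟨z^ 3 ⟩)))
⟨z³⟩-monomial-⊛ (suc e) f 2 = sym (trans
  (monomial-suc-⊛-suc 1ℤ (2 ℕ.+ e ℕ.* 3) (f ⟨z^ 3 ⟩) 1) (trans
  (monomial-suc-⊛-suc 1ℤ (1 ℕ.+ e ℕ.* 3) (f ⟨z^ 3 ⟩) 0)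
  (monomial-suc-⊛-zero 1ℤ (e ℕ.* 3) (f ⟨z^ 3 ⟩))))
⟨z³⟩-monomial-⊛ (suc e) f (suc (suc (suc n))) = begin
  ((monomial 1ℤ (suc e) ⊛ f) ⟨z^ 3 ⟩) (3 ℕ.+ n)
    ≡⟨ ⟨z³⟩-tail (monomial 1ℤ (suc e) ⊛ f) n ⟩
  (tail (monomial 1ℤ (suc e) ⊛ f) ⟨z^ 3 ⟩) n
    ≡⟨ ⟨z³⟩-cong (monomial-suc-⊛-suc 1ℤ e f) n ⟩
  ((monomial 1ℤ e ⊛ f) ⟨z^ 3 ⟩) n
    ≡⟨ ⟨z³⟩-monomial-⊛ e f n ⟩
  (monomial 1ℤ (e ℕ.* 3) ⊛ g) n
    ≡⟨ monomial-suc-⊛-suc 1ℤ (e ℕ.* 3) g n ⟨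
  (monomial 1ℤ (1 ℕ.+ e ℕ.* 3) ⊛ g) (1 ℕ.+ n)
    ≡⟨ monomial-suc-⊛-suc 1ℤ (1 ℕ.+ e ℕ.* 3) g (1 ℕ.+ n) ⟨
  (monomial 1ℤ (2 ℕ.+ e ℕ.* 3) ⊛ g) (2 ℕ.+ n)
    ≡⟨ monomial-suc-⊛-suc 1ℤ (2 ℕ.+ e ℕ.* 3) g (2 ℕ.+ n) ⟨
  (monomial 1ℤ (suc e ℕ.* 3) ⊛ g) (3 ℕ.+ n) ∎
  where
  open ≡-Reasoning
  g = f ⟨z^ 3 ⟩

-- The substitution raises the index of each factor by one, so `Ψ-partial k ⟨z^ 3 ⟩` is the product
-- of the factors with indices 1 to `k`.
⟨z³⟩-Ψ-factor-⊛ : ∀ k f →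
  (Ψ-factor k ⊛ f) ⟨z^ 3 ⟩ ≗ Ψ-factor (suc k) ⊛ f ⟨z^ 3 ⟩
⟨z³⟩-Ψ-factor-⊛ k f n = begin
  ((Ψ-factor k ⊛ f) ⟨z^ 3 ⟩) n
    ≡⟨ ⟨z³⟩-cong (⊛-distribʳ (monomial 1ℤ 0) (monomial 1ℤ (3 ℕ.^ k)) f) n ⟩
  (((monomial 1ℤ 0 ⊛ f) ⊕ (monomial 1ℤ (3 ℕ.^ k) ⊛ f)) ⟨z^ 3 ⟩) n
    ≡⟨ ⟨z³⟩-⊕ (monomial 1ℤ 0 ⊛ f) (monomial 1ℤ (3 ℕ.^ k) ⊛ f) n ⟩
  ((monomial 1ℤ 0 ⊛ f) ⟨z^ 3 ⟩) n ℤ.+ ((monomial 1ℤ (3 ℕ.^ k) ⊛ f) ⟨z^ 3 ⟩) n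
    ≡⟨ cong₂ ℤ._+_ (⟨z³⟩-monomial-⊛ 0 f n) (⟨z³⟩-monomial-⊛ (3 ℕ.^ k) f n) ⟩
  (monomial 1ℤ 0 ⊛ g) n ℤ.+ (monomial 1ℤ (3 ℕ.^ k ℕ.* 3) ⊛ g) n
    ≡⟨ cong (λ e → (monomial 1ℤ 0 ⊛ g) n ℤ.+ (monomial 1ℤ e ⊛ g) n)
         (ℕₚ.*-comm (3 ℕ.^ k) 3) ⟩
  (monomial 1ℤ 0 ⊛ g) n ℤ.+ (monomial 1ℤ (3 ℕ.^ suc k) ⊛ g) n
    ≡⟨ ⊛-distribʳ (monomial 1ℤ 0) (monomial 1ℤ (3 ℕ.^ suc k)) g n ⟨
  (Ψ-factor (suc k) ⊛ g) n ∎
  where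
  open ≡-Reasoning
  g = f ⟨z^ 3 ⟩

⟨z³⟩-one : monomial 1ℤ 0 ⟨z^ 3 ⟩ ≗ ⟦ 1ℤ ∷ [] ⟧
⟨z³⟩-one 0 = refl
⟨z³⟩-one 1 = refl
⟨z³⟩-one 2 = refl
⟨z³⟩-one (suc (suc (suc n))) with ⟨z³⟩-tail (monomial 1ℤ 0) n
... | eq with does (3 ℕᵈ.∣? n)
...   | true  = eq
...   | false = eq

-- Ψ(z³) modulo 3

1+z³ : Poly
1+z³ = nats (1 ∷ 0 ∷ 0 ∷ 1 ∷ [])

Ψ⟨z³⟩-truncated : ∀ n k → n ≤ k → (Ψ ⟨z^ 3 ⟩) n ≡ (Ψ-partial k ⟨z^ 3 ⟩) n
Ψ⟨z³⟩-truncated n k n≤k = cong (λ x → if does (3 ℕᵈ.∣? n) then x else 0ℤ)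
  (sym (Ψ-limit (n ℕ./ 3) k (ℕₚ.≤-trans (ℕᵐ.m/n≤m n 3) n≤k)))

n<3^1+n : ∀ n → n ℕ.< 3 ℕ.^ suc n
n<3^1+n zero    = s≤s z≤n
n<3^1+n (suc n) = ℕₚ.+-mono-≤ (ℕₚ.m^n>0 3 (suc n))
  (ℕₚ.≤-trans (n<3^1+n n) (ℕₚ.m≤m+n (3 ℕ.^ suc n) _))

Ψ-factor-truncated : ∀ n → Ψ-factor (suc n) n ≡ ⟦ 1ℤ ∷ [] ⟧ n
Ψ-factor-truncated n = trans
  (cong (λ b → monomial 1ℤ 0 n ℤ.+ (if b then 1ℤ else 0ℤ))
    (dec-false (3 ℕ.^ suc n ℕₚ.≟ n) (ℕₚ.<⇒≢ (n<3^1+n n) ∘ sym)))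
  (trans (ℤₚ.+-identityʳ _) (monomial₀-≗ 1ℤ n))

module _ where
  open Modulo 3
  open import Relation.Binary.Reasoning.Setoid setoid

  opaque
    unfolding _∔_ _·_

    Ψ-factor-≈ : ∀ k → Ψ-factor k ≈ ⟦ 1ℤ ∷ [] ⟧ ∔ monomial 1ℤ (3 ℕ.^ k)
    Ψ-factor-≈ k = ≗⇒≈ λ n →
      cong (ℤ._+ monomial 1ℤ (3 ℕ.^ k) n) (monomial₀-≗ 1ℤ n)

    monomial-· : ∀ d e → monomial 1ℤ d · monomial 1ℤ e ≈ monomial 1ℤ (d ℕ.+ e)
    monomial-· d e = ≗⇒≈ (monomial-⊛ d e)

    Ψ-partial⟨z³⟩-suc : ∀ k →
      Ψ-partial (suc k) ⟨z^ 3 ⟩ ≈ Ψ-factor (suc k) · Ψ-partial k ⟨z^ 3 ⟩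
    Ψ-partial⟨z³⟩-suc k = ≗⇒≈ (⟨z³⟩-Ψ-factor-⊛ k (Ψ-partial k))

    Ψ⟨z³⟩²-truncated : ∀ f n → (f · (Ψ ⟨z^ 3 ⟩ · Ψ ⟨z^ 3 ⟩)) n ∼
      (f · (Ψ-partial n ⟨z^ 3 ⟩ · Ψ-partial n ⟨z^ 3 ⟩)) n
    Ψ⟨z³⟩²-truncated f n =
      ⊛-cong-≤ n {f} {f} {X · X} {Y · Y} (λ _ → ∼-reflexive refl) λ {i} i≤n →
        ⊛-cong-≤ i {X} {Y} {X} {Y} (truncated i≤n) (truncated i≤n)
      where
      X Y : PowerSeries
      X = Ψ ⟨z^ 3 ⟩
      Y = Ψ-partial n ⟨z^ 3 ⟩
      truncated : ∀ {i j} → i ≤ n → j ≤ i → X j ∼ Y j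
      truncated {j = j} i≤n j≤i =
        ∼-reflexive (Ψ⟨z³⟩-truncated j n (ℕₚ.≤-trans j≤i i≤n))

  Ψ-factor-cubed : ∀ k →
    Ψ-factor k · Ψ-factor k · Ψ-factor k ≈ Ψ-factor (suc k)
  Ψ-factor-cubed k = begin
    Ψ-factor k · Ψ-factor k · Ψ-factor k
      ≈⟨ *-cong (*-cong (Ψ-factor-≈ k) (Ψ-factor-≈ k)) (Ψ-factor-≈ k) ⟩
    eval ((int 1 :+ x₀) :* (int 1 :+ x₀) :* (int 1 :+ x₀)) (monomial 1ℤ d ∷ [])
      -- The cube is nested like `d ℕ.+ (d ℕ.+ (d ℕ.+ 0))`, to which the exponent `3 ℕ.^ suc k`
      -- computes.
      ≈⟨ solve-≈ ((int 1 :+ x₀) :* (int 1 :+ x₀) :* (int 1 :+ x₀))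
           (int 1 :+ x₀ :* (x₀ :* (x₀ :* int 1))) (monomial 1ℤ d ∷ []) refl ⟩
    eval (int 1 :+ x₀ :* (x₀ :* (x₀ :* int 1))) (monomial 1ℤ d ∷ [])
      ≈⟨ +-congˡ (power (power (power (≗⇒≈ (sym ∘ monomial₀-≗ 1ℤ))))) ⟩
    ⟦ 1ℤ ∷ [] ⟧ ∔ monomial 1ℤ (3 ℕ.^ suc k)
      ≈⟨ Ψ-factor-≈ (suc k) ⟨
    Ψ-factor (suc k) ∎
    where
    d = 3 ℕ.^ k
    power : ∀ {e f} → f ≈ monomial 1ℤ e →
      monomial 1ℤ d · f ≈ monomial 1ℤ (d ℕ.+ e)
    power {e} f≈ = ≈-trans (*-congˡ f≈) (monomial-· d e)

  -- The factors telescope because 1 + y³ ≡ (1 + y)³.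
  Ψ-partial⟨z³⟩-squared : ∀ k →
    ⟦ 1+z³ ⟧ · (Ψ-partial k ⟨z^ 3 ⟩ · Ψ-partial k ⟨z^ 3 ⟩) ≈ Ψ-factor (suc k)
  Ψ-partial⟨z³⟩-squared zero = begin
    ⟦ 1+z³ ⟧ · (one · one)
      ≈⟨ *-congˡ (*-cong (≗⇒≈ ⟨z³⟩-one) (≗⇒≈ ⟨z³⟩-one)) ⟩
    ⟦ 1+z³ ⟧ · (⟦ 1ℤ ∷ [] ⟧ · ⟦ 1ℤ ∷ [] ⟧)
      ≈⟨ solve-≈ (con 1+z³ :* (int 1 :* int 1)) (con 1+z³) (one ∷ []) refl ⟩
    ⟦ 1+z³ ⟧
      ≈⟨ ≗⇒≈ (λ { 0 → refl ; 1 → refl ; 2 → refl ; 3 → refl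
                ; (suc (suc (suc (suc n)))) → refl }) ⟩
    Ψ-factor 1 ∎
    where one = Ψ-partial 0 ⟨z^ 3 ⟩
  Ψ-partial⟨z³⟩-squared (suc k) = begin
    ⟦ 1+z³ ⟧ · (Ψ-partial (suc k) ⟨z^ 3 ⟩ · Ψ-partial (suc k) ⟨z^ 3 ⟩)
      ≈⟨ *-congˡ (*-cong (Ψ-partial⟨z³⟩-suc k) (Ψ-partial⟨z³⟩-suc k)) ⟩
    ⟦ 1+z³ ⟧ · ((y · x) · (y · x))
      ≈⟨ solve-≈ (con 1+z³ :* ((x₀ :* x₁) :* (x₀ :* x₁)))
           ((x₀ :* x₀) :* (con 1+z³ :* (x₁ :* x₁))) (y ∷ x ∷ []) refl ⟩
    y · y · (⟦ 1+z³ ⟧ · (x · x))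
      ≈⟨ *-congˡ (Ψ-partial⟨z³⟩-squared k) ⟩
    y · y · y
      ≈⟨ Ψ-factor-cubed (suc k) ⟩
    Ψ-factor (2 ℕ.+ k) ∎
    where
    x = Ψ-partial k ⟨z^ 3 ⟩
    y = Ψ-factor (suc k)

  -- For coefficient `n` it suffices to keep `n` factors. These telescope to `Ψ-factor (suc n)`,
  -- whose second term has exponent greater than `n`.
  Ψ⟨z³⟩-squared : ⟦ 1+z³ ⟧ · (Ψ ⟨z^ 3 ⟩ · Ψ ⟨z^ 3 ⟩) ≈ ⟦ 1ℤ ∷ [] ⟧
  Ψ⟨z³⟩-squared = pointwise λ n → ∼-trans (Ψ⟨z³⟩²-truncated ⟦ 1+z³ ⟧ n)
    (∼-trans (at (Ψ-partial⟨z³⟩-squared n) n)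
      (∼-reflexive (Ψ-factor-truncated n)))

-- Counting paths by starting height

module _ {A B : Set} {P : B → Set} {Q : A → Set}
  (P? : Decidable P) (Q? : Decidable Q) (g : A → B)
  (same : ∀ x → does (P? (g x)) ≡ does (Q? x)) where

  length-filter-map : ∀ xs →
    length (filter P? (map g xs)) ≡ length (filter Q? xs)
  length-filter-map []       = refl
  length-filter-map (x ∷ xs) with does (P? (g x)) | does (Q? x) | same x
  ... | true  | true  | refl = cong suc (length-filter-map xs)
  ... | false | false | refl = length-filter-map xs

paths : ℤ → ℕ → ℕ
paths h n = length (filter (isPathFrom? h) (words n))

-- Words are grouped by their first step. The height after a down step stays an integer sum because
-- it is -1 when `h` is 0.
paths-suc : ∀ h n → paths (+ h) (suc n) ≡
  paths (+ h) n ℕ.+ (paths (+ suc h) n ℕ.+ paths (+ h ℤ.+ ℤ.-1ℤ) n)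
paths-suc h n = begin
  paths (+ h) (suc n)
    ≡⟨ split (map (level ∷_) (words n)) _ ⟩
  len (map (level ∷_) (words n)) ℕ.+
    len (map (up ∷_) (words n) ++ map (down ∷_) (words n) ++ [])
    ≡⟨ cong₂ ℕ._+_ (first level)
         (trans (split (map (up ∷_) (words n)) _)
           (cong₂ ℕ._+_ (first up)
             (trans (split (map (down ∷_) (words n)) [])
               (trans (ℕₚ.+-identityʳ _) (first down))))) ⟩
  paths (+ h ℤ.+ 0ℤ) n ℕ.+ (paths (+ h ℤ.+ 1ℤ) n ℕ.+ paths (+ h ℤ.+ ℤ.-1ℤ) n)
    ≡⟨ cong₂ (λ a b → paths (+ a) n ℕ.+ (paths (+ b) n ℕ.+ paths (+ h ℤ.+ ℤ.-1ℤ) n))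
         (ℕₚ.+-identityʳ h) (ℕₚ.+-comm h 1) ⟩
  paths (+ h) n ℕ.+ (paths (+ suc h) n ℕ.+ paths (+ h ℤ.+ ℤ.-1ℤ) n) ∎
  where
  open ≡-Reasoning
  len : List (Vec Step (suc n)) → ℕ
  len ws = length (filter (isPathFrom? (+ h)) ws)
  split : ∀ ws ws′ → len (ws ++ ws′) ≡ len ws ℕ.+ len ws′
  split ws ws′ = trans (cong length (filter-++ (isPathFrom? (+ h)) ws ws′))
    (length-++ (filter (isPathFrom? (+ h)) ws))
  first : ∀ s → len (map (s ∷_) (words n)) ≡ paths (+ h ℤ.+ rise s) n
  -- At a height `+ h` the nonnegativity test computes to true, so both decisions yield the same
  -- Boolean.
  first s = length-filter-map (isPathFrom? (+ h)) (isPathFrom? (+ h ℤ.+ rise s))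
    (s ∷_) (λ _ → refl) (words n)

paths-below : ∀ n → paths ℤ.-1ℤ n ≡ 0
paths-below n = none (words n)
  where
  none : ∀ (ws : List (Vec Step n)) →
    length (filter (isPathFrom? ℤ.-1ℤ) ws) ≡ 0
  none []             = refl
  none ([] ∷ ws)      = none ws
  none ((s ∷ w) ∷ ws) = none ws

-- Coefficients of Laurent series

k+p-p : ∀ k p → (k ℤ.+ + p) ℤ.- + p ≡ k
k+p-p k p = trans (ℤₚ.+-assoc k (+ p) (ℤ.- + p))
  (trans (cong (ℤ._+_ k) (ℤₚ.+-inverseʳ (+ p))) (ℤₚ.+-identityʳ k))

atℤ-negative : ∀ f j d → atℤ f (-[1+ j ] ℤ.- + d) ≡ 0ℤ
atℤ-negative f j zero    = refl
atℤ-negative f j (suc d) = refl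

-- In a sum, `p` is the larger pole. An exponent below `- p` is also below minus the pole of `f`,
-- since passing from `p` to the smaller pole only decreases the index.
coeff-below-pole : ∀ f {p j} k → pole f ≤ p → k ℤ.+ + p ≡ -[1+ j ] →
  coeff f k ≡ 0ℤ
coeff-below-pole f {p} {j} k q≤p eq = begin
  atℤ (body f) (k ℤ.+ + q)              ≡⟨ cong (atℤ (body f)) k+q ⟩
  atℤ (body f) (-[1+ j ] ℤ.- + (p ℕ.∸ q)) ≡⟨ atℤ-negative (body f) j (p ℕ.∸ q) ⟩
  0ℤ                                    ∎
  where
  open ≡-Reasoning
  q = pole f
  k+q : k ℤ.+ + q ≡ -[1+ j ] ℤ.- + (p ℕ.∸ q)
  k+q = begin
    k ℤ.+ + q
      ≡⟨ k+p-p (k ℤ.+ + q) (p ℕ.∸ q) ⟨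
    k ℤ.+ + q ℤ.+ + (p ℕ.∸ q) ℤ.- + (p ℕ.∸ q)
      ≡⟨ cong (λ x → x ℤ.- + (p ℕ.∸ q)) (ℤₚ.+-assoc k (+ q) (+ (p ℕ.∸ q))) ⟩
    k ℤ.+ + (q ℕ.+ (p ℕ.∸ q)) ℤ.- + (p ℕ.∸ q)
      ≡⟨ cong (λ x → k ℤ.+ + x ℤ.- + (p ℕ.∸ q)) (ℕₚ.m+[n∸m]≡n q≤p) ⟩
    k ℤ.+ + p ℤ.- + (p ℕ.∸ q)
      ≡⟨ cong (λ x → x ℤ.- + (p ℕ.∸ q)) eq ⟩
    -[1+ j ] ℤ.- + (p ℕ.∸ q) ∎

coeff-+ : ∀ f g k → coeff (f + g) k ≡ coeff f k ℤ.+ coeff g k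
coeff-+ f g k with k ℤ.+ + (pole f ℕ.⊔ pole g) in eq
-- For a nonnegative index `n`, the difference `n ⊖ p` recovers `k`; otherwise `k` lies below both
-- poles.
... | + n = cong (λ i → coeff f i ℤ.+ coeff g i) (begin
  n ⊖ p               ≡⟨ ℤₚ.m-n≡m⊖n n p ⟨
  + n ℤ.- + p         ≡⟨ cong (λ x → x ℤ.- + p) eq ⟨
  k ℤ.+ + p ℤ.- + p   ≡⟨ k+p-p k p ⟩
  k                   ∎)
  where
  open ≡-Reasoning
  p = pole f ℕ.⊔ pole g
... | -[1+ j ] = sym (cong₂ ℤ._+_
  (coeff-below-pole f k (ℕₚ.m≤m⊔n (pole f) (pole g)) eq)
  (coeff-below-pole g k (ℕₚ.m≤n⊔m (pole f) (pole g)) eq))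

-- The Motzkin equation modulo 27

-- The polynomials of the theorem, multiplied by z²; aₚ is (1 - z) / 2.
aₚ pₚ qₚ rₚ : Poly
aₚ = nats (14 ∷ 13 ∷ [])
pₚ = nats (21 ∷ 24 ∷ 12 ∷ 9 ∷ [])
qₚ = nats (4 ∷ 14 ∷ 19 ∷ 25 ∷ 23 ∷ 10 ∷ 12 ∷ 9 ∷ [])
rₚ = nats (12 ∷ 24 ∷ 3 ∷ 6 ∷ 21 ∷ 6 ∷ 30 ∷ 24 ∷ 3 ∷ 9 ∷ [])

-- (1 - 2z - 3z²) / 4 modulo 27.
kₚ : Poly
kₚ = nats (7 ∷ 13 ∷ 6 ∷ [])

zₚ : Poly
zₚ = nats (0 ∷ 1 ∷ [])

opaque
  unfolding _·_

  z·-zero : ∀ f → (⟦ zₚ ⟧ · f) 0 ≡ 0ℤ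
  z·-zero f = trans (ℤₚ.+-identityʳ _) (ℤₚ.*-zeroˡ (f 0))

  z·-suc : ∀ f n → (⟦ zₚ ⟧ · f) (suc n) ≡ f n
  z·-suc f n = trans (cong₂ ℤ._+_ (ℤₚ.*-zeroˡ (f (suc n))) (⊛-identityˡ f n))
    (ℤₚ.+-identityˡ (f n))

-- A path from height h down to 0 consists of h + 1 excursions joined by h
-- down steps.
excursions : PowerSeries → ℕ → PowerSeries
excursions f zero    = f
excursions f (suc h) = ⟦ zₚ ⟧ · (f · excursions f h)

module _ where
  open Modulo 27
  import Relation.Binary.Reasoning.Setoid setoid as ≈-Reasoning

  z-cancel : ∀ {f g} → ⟦ zₚ ⟧ · f ≈ ⟦ zₚ ⟧ · g → f ≈ g
  z-cancel {f} {g} e = pointwise λ n →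
    ∼-trans (∼-reflexive (sym (z·-suc f n)))
      (∼-trans (at e (suc n)) (∼-reflexive (z·-suc g n)))

  z-unshift : ∀ f → f 0 ∼ 0ℤ → f ≈ ⟦ zₚ ⟧ · tail f
  z-unshift f f₀∼0 = pointwise λ where
    zero    → ∼-trans f₀∼0 (∼-reflexive (sym (z·-zero (tail f))))
    (suc n) → ∼-reflexive (sym (z·-suc (tail f) n))

  A P Q R T K Z : ∀ {n} → Polynomial n
  A = con aₚ
  P = con pₚ
  Q = con qₚ
  R = con rₚ
  T = con 1+z³
  K = con kₚ
  Z = con zₚ

  -- root X is the part of the right-hand side that is odd in X = Ψ(z³), times
  -- z², and root² (T X²) is T⁵ (root X)².
  root root² : ∀ {n} → Polynomial n → Polynomial n
  root x = P :* x :+ Q :* x :^ 3 :- R :* x :^ 5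
  root² w = w :* (P :* T :^ 2 :+ Q :* T :* w :- R :* w :^ 2) :^ 2

  -- Their product is 1 + 27u³, so they are inverse to each other modulo 27.
  1+3u 1-3u+9u² : ∀ {n} → Polynomial n → Polynomial n
  1+3u u = int 1 :+ int 3 :* u
  1-3u+9u² u = int 1 :- int 3 :* u :+ int 9 :* (u :* u)

  motzkin : ∀ {n} → Polynomial n → Polynomial n
  motzkin x = int 1 :+ Z :* x :+ Z :* (Z :* (x :* x))

  -- The square of `root x` has only even powers of `x`, up to the tenth, so multiplying by the
  -- fifth power of 1 + z³ makes it a polynomial in z and (1 + z³)x². As the latter is the unit 1 +
  -- 3u, the factor 1 + z³ is invertible and can be cancelled.
  root-squared : ∀ x u → ⟦ 1+z³ ⟧ · (x · x) ≈ eval (1+3u x₀) (u ∷ []) →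
    eval (root x₀ :* root x₀) (x ∷ []) ≈ ⟦ kₚ ⟧
  root-squared x u tx² = begin
    s²                       ≈⟨ t⁵-inverse s² ⟨
    eval (x₀ :^ 5) (y ∷ []) · (eval (x₀ :^ 5) (⟦ 1+z³ ⟧ ∷ []) · s²)
      ≈⟨ *-congˡ t⁵s² ⟩
    eval (x₀ :^ 5) (y ∷ []) · (eval (x₀ :^ 5) (⟦ 1+z³ ⟧ ∷ []) · ⟦ kₚ ⟧)
      ≈⟨ t⁵-inverse ⟦ kₚ ⟧ ⟩
    ⟦ kₚ ⟧ ∎
    where
    open ≈-Reasoning
    s² = eval (root x₀ :* root x₀) (x ∷ [])
    v = eval (1-3u+9u² x₀) (u ∷ [])
    y = (x · x) · v

    ty≈1 : ⟦ 1+z³ ⟧ · y ≈ ⟦ 1ℤ ∷ [] ⟧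
    ty≈1 = begin
      ⟦ 1+z³ ⟧ · y
        ≈⟨ ≈-sym (*-assoc ⟦ 1+z³ ⟧ (x · x) v) ⟩
      (⟦ 1+z³ ⟧ · (x · x)) · v
        ≈⟨ *-congʳ tx² ⟩
      eval (1+3u x₀) (u ∷ []) · v
        ≈⟨ solve-≈ (1+3u x₀ :* 1-3u+9u² x₀) (int 1) (u ∷ []) refl ⟩
      ⟦ 1ℤ ∷ [] ⟧ ∎

    t⁵-inverse : ∀ f →
      eval (x₀ :^ 5) (y ∷ []) · (eval (x₀ :^ 5) (⟦ 1+z³ ⟧ ∷ []) · f) ≈ f
    t⁵-inverse f = begin
      eval (x₀ :^ 5) (y ∷ []) · (eval (x₀ :^ 5) (⟦ 1+z³ ⟧ ∷ []) · f)
        ≈⟨ solve-≈ (x₀ :^ 5 :* (T :^ 5 :* x₁)) ((T :* x₀) :^ 5 :* x₁) (y ∷ f ∷ []) refl ⟩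
      eval (x₀ :^ 5) ((⟦ 1+z³ ⟧ · y) ∷ []) · f
        ≈⟨ *-congʳ (eval-cong (x₀ :^ 5) ty≈1) ⟩
      eval (x₀ :^ 5) (⟦ 1ℤ ∷ [] ⟧ ∷ []) · f
        ≈⟨ solve-≈ (int 1 :^ 5 :* x₀) x₀ (f ∷ []) refl ⟩
      f ∎

    t⁵s² : eval (x₀ :^ 5) (⟦ 1+z³ ⟧ ∷ []) · s² ≈ eval (x₀ :^ 5) (⟦ 1+z³ ⟧ ∷ []) · ⟦ kₚ ⟧
    t⁵s² = begin
      eval (x₀ :^ 5) (⟦ 1+z³ ⟧ ∷ []) · s²
        ≈⟨ solve-≈ (T :^ 5 :* (root x₀ :* root x₀)) (root² (T :* (x₀ :* x₀))) (x ∷ []) refl ⟩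
      eval (root² x₀) (⟦ 1+z³ ⟧ · (x · x) ∷ [])
        ≈⟨ eval-cong (root² x₀) tx² ⟩
      eval (root² (1+3u x₀)) (u ∷ [])
        -- All terms containing `u` cancel modulo 27, so nothing more about `u` has to be known.
        ≈⟨ solve-≈ (root² (1+3u x₀)) (T :^ 5 :* K) (u ∷ []) refl ⟩
      eval (x₀ :^ 5) (⟦ 1+z³ ⟧ ∷ []) · ⟦ kₚ ⟧ ∎

  -- For y = z²f, the equation times z² reads y = z² + zy + y². Completing the square with y = (1 -
  -- z)/2 + s turns it into s² = (1 - 2z - 3z²)/4.
  motzkin-equation : ∀ s f → s · s ≈ ⟦ kₚ ⟧ →
    ⟦ aₚ ⟧ ∔ s ≈ ⟦ zₚ ⟧ · (⟦ zₚ ⟧ · f) →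
    f ≈ eval (motzkin x₀) (f ∷ [])
  motzkin-equation s f s²≈k a+s≈z²f = z-cancel (z-cancel (begin
    ⟦ zₚ ⟧ · (⟦ zₚ ⟧ · f)
      ≈⟨ a+s≈z²f ⟨
    ⟦ aₚ ⟧ ∔ s
      -- Since `aₚ` is (1 - z)/2 modulo 27, the linear coefficient `Z :+ A :+ A` is 1, and `K` makes
      -- up the difference of the constant terms.
      ≈⟨ solve-≈ (A :+ x₀) (rest :+ K) (s ∷ []) refl ⟩
    eval rest (s ∷ []) ∔ ⟦ kₚ ⟧
      ≈⟨ +-congˡ s²≈k ⟨
    eval rest (s ∷ []) ∔ (s · s)
      ≈⟨ solve-≈ (rest :+ x₀ :* x₀) (quadratic (A :+ x₀)) (s ∷ []) refl ⟩
    eval (quadratic x₀) (⟦ aₚ ⟧ ∔ s ∷ [])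
      ≈⟨ eval-cong (quadratic x₀) a+s≈z²f ⟩
    eval (quadratic x₀) (⟦ zₚ ⟧ · (⟦ zₚ ⟧ · f) ∷ [])
      ≈⟨ solve-≈ (quadratic (Z :* (Z :* x₀)))
           (Z :* (Z :* (motzkin x₀))) (f ∷ []) refl ⟩
    ⟦ zₚ ⟧ · (⟦ zₚ ⟧ · eval (motzkin x₀) (f ∷ [])) ∎))
    where
    open ≈-Reasoning
    quadratic : ∀ {n} → Polynomial n → Polynomial n
    quadratic x = Z :* Z :+ Z :* x :+ x :* x
    rest : Polynomial 1
    rest = (Z :* Z :+ Z :* A :+ A :* A) :+ (Z :+ A :+ A) :* x₀

  -- Path counts from the Motzkin equation

  module _ {f} (equation : f ≈ eval (motzkin x₀) (f ∷ [])) where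

    private
      H = excursions f

    excursions-zero : H 0 ≈ ⟦ 1ℤ ∷ [] ⟧ ∔ ⟦ zₚ ⟧ · (H 0 ∔ H 1)
    excursions-zero = ≈-trans equation
      (solve-≈ (motzkin x₀) (int 1 :+ Z :* (x₀ :+ Z :* (x₀ :* x₀))) (f ∷ []) refl)

    excursions-suc : ∀ h →
      H (suc h) ≈ ⟦ zₚ ⟧ · (H (suc h) ∔ (H (suc (suc h)) ∔ H h))
    -- Only the leading factor `f` of `H (suc h)` is expanded; its terms 1, zf and z²f² correspond
    -- to a first step down, level and up.
    excursions-suc h = ≈-trans (*-congˡ (*-congʳ equation))
      (solve-≈ (Z :* (motzkin x₀ :* x₁))
        (Z :* (Z :* (x₀ :* x₁) :+ (Z :* (x₀ :* (Z :* (x₀ :* x₁))) :+ x₁)))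
        (f ∷ H h ∷ []) refl)

    -- The induction on `n` treats all heights at once, because a first step may change the height.
    paths-∼ : ∀ n h → + paths (+ h) n ∼ H h n
    paths-∼ zero zero = ∼-sym (∼-trans (at excursions-zero 0)
      (∼-reflexive (trans (∔-at _ _ 0) (cong (ℤ._+_ 1ℤ) (z·-zero (H 0 ∔ H 1))))))
    paths-∼ zero (suc h) = ∼-reflexive (sym (z·-zero (f · H h)))
    paths-∼ (suc n) zero = ∼-trans
      (∼-reflexive (cong (λ m → + m) (trans (paths-suc 0 n)
        (cong (λ m → paths 0ℤ n ℕ.+ (paths 1ℤ n ℕ.+ m)) (paths-below n)))))
      (∼-trans
        (∼-+ (paths-∼ n 0) (∼-trans
          (∼-reflexive (cong (λ m → + m) (ℕₚ.+-identityʳ (paths 1ℤ n))))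
          (paths-∼ n 1)))
        (∼-sym (∼-trans (at excursions-zero (suc n))
          (∼-reflexive (trans (∔-at _ _ (suc n)) (trans (ℤₚ.+-identityˡ _)
            (trans (z·-suc (H 0 ∔ H 1) n) (∔-at (H 0) (H 1) n))))))))
    paths-∼ (suc n) (suc h) = ∼-trans
      (∼-reflexive (cong (λ m → + m) (paths-suc (suc h) n)))
      (∼-trans (∼-+ (paths-∼ n (suc h)) (∼-+ (paths-∼ n (suc (suc h))) (paths-∼ n h)))
        (∼-sym (∼-trans (at (excursions-suc h) (suc n))
          (∼-reflexive (trans (z·-suc (H (suc h) ∔ (H (suc (suc h)) ∔ H h)) n)
            (trans (∔-at (H (suc h)) _ n)
              (cong (ℤ._+_ (H (suc h) n)) (∔-at (H (suc (suc h))) (H h) n))))))))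

  -- Laurent series as z⁻² times a power series

  infix 4 _≐z⁻²_

  _≐z⁻²_ : Laurent → PowerSeries → Set
  L ≐z⁻² f = ∀ k → coeff L k ∼ atℤ f (k ℤ.+ + 2)

  atℤ-cong : ∀ {f g} → f ≈ g → ∀ k → atℤ f k ∼ atℤ g k
  atℤ-cong f≈g (+ n)    = at f≈g n
  atℤ-cong f≈g -[1+ n ] = ∼-reflexive refl

  ≐-body : ∀ L {f} → pole L ≡ 2 → body L ≈ f → L ≐z⁻² f
  ≐-body (laurent _ _) refl b≈f k = atℤ-cong b≈f (k ℤ.+ + 2)

  ≐-series : ∀ f → series f ≐z⁻² ⟦ zₚ ⟧ · (⟦ zₚ ⟧ · f)
  ≐-series f (+ n) = ∼-reflexive (begin
    f (n ℕ.+ 0)                              ≡⟨ cong f (ℕₚ.+-identityʳ n) ⟩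
    f n                                      ≡⟨ z·-suc f n ⟨
    (⟦ zₚ ⟧ · f) (1 ℕ.+ n)                   ≡⟨ z·-suc (⟦ zₚ ⟧ · f) (1 ℕ.+ n) ⟨
    (⟦ zₚ ⟧ · (⟦ zₚ ⟧ · f)) (2 ℕ.+ n)
      ≡⟨ cong (⟦ zₚ ⟧ · (⟦ zₚ ⟧ · f)) (ℕₚ.+-comm 2 n) ⟩
    (⟦ zₚ ⟧ · (⟦ zₚ ⟧ · f)) (n ℕ.+ 2)        ∎)
    where open ≡-Reasoning
  -- The exponents -1 and -2 become the indices 1 and 0, where z²f has coefficient 0.
  ≐-series f -[1+ 0 ] = ∼-reflexive
    (sym (trans (z·-suc (⟦ zₚ ⟧ · f) 0) (z·-zero f)))
  ≐-series f -[1+ 1 ] = ∼-reflexive (sym (z·-zero (⟦ zₚ ⟧ · f)))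
  ≐-series f -[1+ suc (suc j) ] = ∼-reflexive refl

  opaque
    unfolding _∔_ _·_ ⊝_

    ≐-+ : ∀ L L′ {f g} → L ≐z⁻² f → L′ ≐z⁻² g → L + L′ ≐z⁻² f ∔ g
    ≐-+ L L′ {f} {g} L≐f L′≐g k = ∼-trans (∼-reflexive (coeff-+ L L′ k))
      (∼-trans (∼-+ (L≐f k) (L′≐g k)) (∼-reflexive (atℤ-⊕ (k ℤ.+ + 2))))
      where
      atℤ-⊕ : ∀ i → atℤ f i ℤ.+ atℤ g i ≡ atℤ (f ⊕ g) i
      atℤ-⊕ (+ n)    = refl
      atℤ-⊕ -[1+ n ] = refl

    ≐-- : ∀ L L′ {f g} → L ≐z⁻² f → L′ ≐z⁻² g → L - L′ ≐z⁻² f ∔ ⊝ g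
    ≐-- L L′ {f} {g} L≐f L′≐g =
      ≐-+ L (laurent (pole L′) (ℤ.-_ ∘ body L′)) L≐f λ k →
        ∼-trans (∼-reflexive (sym (atℤ-neg (body L′) (k ℤ.+ + pole L′))))
          (∼-trans (∼-neg (L′≐g k)) (∼-reflexive (atℤ-neg g (k ℤ.+ + 2))))
      where
      atℤ-neg : ∀ h i → ℤ.- atℤ h i ≡ atℤ (ℤ.-_ ∘ h) i
      atℤ-neg h (+ n)    = refl
      atℤ-neg h -[1+ n ] = refl

    body-* : ∀ f g → body (f * g) ≈ body f · body g
    body-* f g = ≈-refl

  body-^ : ∀ f n → body (series f ^ n) ≈ eval (x₀ :^ n) (f ∷ [])
  body-^ f zero    = ≗⇒≈ (monomial₀-≗ 1ℤ)
  body-^ f (suc n) = ≈-trans (body-* (series f) (series f ^ n)) (*-congˡ (body-^ f n))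

  ≐-* : ∀ L {p f g} → pole L ≡ 2 → body L ≈ p →
    pole g ≡ 0 → body g ≈ f → L * g ≐z⁻² p · f
  ≐-* L {g = g} pole≡2 L≈ pole≡0 g≈ =
    ≐-body (L * g) (cong₂ ℕ._+_ pole≡2 pole≡0) (≈-trans (body-* L g) (*-cong L≈ g≈))

  -- The right-hand side of the theorem

  X : PowerSeries
  X = Ψ ⟨z^ 3 ⟩

  aL pL qL rL : Laurent
  aL = 13 z^- 1 + 14 z^- 2
  pL = 9 z^ 1 + 12 z^ 0 + 24 z^- 1 + 21 z^- 2
  qL = 9 z^ 5 + 12 z^ 4 + 10 z^ 3 + 23 z^ 2 + 25 z^ 1 + 19 z^ 0
    + 14 z^- 1 + 4 z^- 2
  rL = 9 z^ 7 + 3 z^ 6 + 24 z^ 5 + 30 z^ 4 + 6 z^ 3 + 21 z^ 2 + 6 z^ 1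
    + 3 z^ 0 + 24 z^- 1 + 12 z^- 2

  aL-body : body aL ≈ ⟦ aₚ ⟧
  aL-body = ≗⇒≈ λ { 0 → refl ; 1 → refl ; 2 → refl ; (suc (suc (suc n))) → refl }

  pL-body : body pL ≈ ⟦ pₚ ⟧
  pL-body = ≗⇒≈ λ { 0 → refl ; 1 → refl ; 2 → refl ; 3 → refl ; 4 → refl
                  ; (suc (suc (suc (suc (suc n))))) → refl }

  qL-body : body qL ≈ ⟦ qₚ ⟧
  qL-body = ≗⇒≈ λ
    { 0 → refl ; 1 → refl ; 2 → refl ; 3 → refl
    ; 4 → refl ; 5 → refl ; 6 → refl ; 7 → refl ; 8 → refl
    ; (suc (suc (suc (suc (suc (suc (suc (suc (suc n))))))))) → refl }

  rL-body : body rL ≈ ⟦ rₚ ⟧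
  rL-body = ≗⇒≈ λ
    { 0 → refl ; 1 → refl ; 2 → refl ; 3 → refl ; 4 → refl
    ; 5 → refl ; 6 → refl ; 7 → refl ; 8 → refl ; 9 → refl ; 10 → refl
    ; (suc (suc (suc (suc (suc (suc (suc (suc (suc (suc (suc n))))))))))) → refl }

  z²F F : PowerSeries
  z²F = ⟦ aₚ ⟧ ∔ eval (root x₀) (X ∷ [])
  F = tail (tail z²F)

  opaque
    unfolding _∔_ _·_ ⊝_

    -- As Ψ(z³) = 1 + O(z³), the constant term is 14 + 21 + 4 - 12 = 27 and the coefficient of z is
    -- 13 + 24 + 14 - 24 = 27. Hence `z²F` is divisible by z² modulo 27.
    z²F-0 : z²F 0 ∼ 0ℤ
    z²F-0 = congruent (from-yes (+ 27 ∣? (z²F 0 ℤ.- 0ℤ)))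

    z²F-1 : z²F 1 ∼ 0ℤ
    z²F-1 = congruent (from-yes (+ 27 ∣? (z²F 1 ℤ.- 0ℤ)))

  z²F-≈ : z²F ≈ ⟦ zₚ ⟧ · (⟦ zₚ ⟧ · F)
  z²F-≈ = ≈-trans (z-unshift z²F z²F-0) (*-congˡ (z-unshift (tail z²F) z²F-1))

  F-equation : F ≈ eval (motzkin x₀) (F ∷ [])
  F-equation = motzkin-equation (eval (root x₀) (X ∷ [])) F
    -- The series `u` consists of the quotients by 3 from the congruence for Ψ(z³)²; the resulting
    -- exact equality is then read modulo 27.
    (root-squared X (quotients₃ Ψ⟨z³⟩-squared) (≗⇒≈ (≈⇒≗₃ Ψ⟨z³⟩-squared))) z²F-≈
    where open Modulo 3 using () renaming (quotients to quotients₃; ≈⇒≗ to ≈⇒≗₃)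

  M≈F : (λ n → + M n) ≈ F
  M≈F = pointwise λ n → paths-∼ F-equation n 0

  rhs-≐ : aL + pL * series X + qL * series X ^ 3 - rL * series X ^ 5 ≐z⁻²
    ⟦ zₚ ⟧ · (⟦ zₚ ⟧ · (λ n → + M n))
  rhs-≐ k = ∼-trans
    (≐-- (aL + pL * series X + qL * series X ^ 3) (rL * series X ^ 5)
      (≐-+ (aL + pL * series X) (qL * series X ^ 3)
        (≐-+ aL (pL * series X)
          (≐-body aL refl aL-body)
          (≐-* pL {g = series X} refl pL-body refl ≈-refl))
        (≐-* qL {g = series X ^ 3} refl qL-body refl (body-^ X 3)))
      (≐-* rL {g = series X ^ 5} refl rL-body refl (body-^ X 5)) k)
    (atℤ-cong (≈-trans (solve-≈
        (A :+ P :* x₀ :+ Q :* x₀ :^ 3 :+ :- (R :* x₀ :^ 5))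
        (A :+ root x₀) (X ∷ []) refl)
      (≈-trans z²F-≈ (*-congˡ (*-congˡ (pointwise (∼-sym ∘ at M≈F))))))
      (k ℤ.+ + 2))

theorem7p2 : series (λ n → + M n)
    ≈ 13 z^- 1 + 14 z^- 2
    + (9 z^ 1 + 12 z^ 0 + 24 z^- 1 + 21 z^- 2) * series (Ψ ⟨z^ 3 ⟩)
    + (9 z^ 5 + 12 z^ 4 + 10 z^ 3 + 23 z^ 2 + 25 z^ 1 + 19 z^ 0
    + 14 z^- 1 + 4 z^- 2) * series (Ψ ⟨z^ 3 ⟩) ^ 3
    - (9 z^ 7 + 3 z^ 6 + 24 z^ 5 + 30 z^ 4 + 6 z^ 3 + 21 z^ 2 + 6 z^ 1
    + 3 z^ 0 + 24 z^- 1 + 12 z^- 2) * series (Ψ ⟨z^ 3 ⟩) ^ 5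
    [mod 27 ]
theorem7p2 k = ∣⇒∣ᵤ (Modulo.difference (Modulo.∼-trans 27 (≐-series (λ n → + M n) k)
  (Modulo.∼-sym 27 (rhs-≐ k))))
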